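{- Let $\pi$ be a derivation of a judgment $\Lambda\vdash t:L$, with $\Lambda$ a ground context and $L$ a ground type. Let $n=|\mathrm{Nm}(\mathrm{Cpts}(\pi))|$ be the number of names which appear in the factors of $\mathrm{Cpts}(\pi)$, and let $m_\pi$ be the number of probabilistic axioms in $\pi$. Then $m_\pi\le n$, and the cost of computing $[\![\pi]\!]$ according to its definition $$[\![\pi]\!]=\sum_{\mathrm{Nm}(\mathrm{Cpts}(\pi))-\mathrm{Nm}(\Lambda\vdash t:L)}\Big(\bigodot_{\phi\in\mathrm{Cpts}(\pi)}\phi\Big)$$ (i.e. first computing the full product, then summing out) is $\mathcal O(m_\pi\cdot2^{n})$.
   Context: **Cost.** Cost is the number of elementary arithmetic operations (multiplications and additions of reals) when factors are stored as tables with one entry per tuple and products and sum outs are computed entrywise from their definitions; a product by the trivial factor $\mathbf 1_\emptyset$ needs no operation. (Thus multiplying $k$ factors costs $\mathcal O(k\cdot 2^w)$, with $w$ the number of names of the result, and summing out any set of names from a factor over $w$ names costs $\mathcal O(2^w)$.) **Terms.** Terms $t,u$ and values $v,w$ (up to $\alpha$-equivalence): $t,u ::= v \mid \mathsf{sample}_d \mid \mathsf{case}\ v\ \mathsf{of}\ \{v_i\Rightarrow \mathsf{sample}_{d_i}\} \mid \mathsf{obs}(x=b) \mid \mathsf{let}\ x=u\ \mathsf{in}\ t \mid \mathsf{letp}\ \langle x,y\rangle=v\ \mathsf{in}\ t \mid t\,v\mid \lambda x.t\mid \mathsf{der}\,v$; $v,w ::= x \mid \langle v,w\rangle \mid\ !t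 \mid b$; $b::=\mathtt t\mid\mathtt f$; $d$ ranges over probability distributions on $\{\mathtt t,\mathtt f\}$. $\mathsf c\langle y_1,\dots,y_n\rangle$ abbreviates $\mathsf{case}\ \langle y_1,\dots,y_n\rangle\ \mathsf{of}\ \{\bar b\Rightarrow\mathsf{sample}_{d_{\bar b}}\}_{\bar b\in\{\mathtt t,\mathtt f\}^n}$. **Intersection types.** Fix a countable set of names $X,Y,Z,\dots$. Ground types $K,L::=X\mid K\otimes L$; positive types $P,Q::=L\mid[A_1,\dots,A_n]$ (finite multiset, $n\ge0$); types $A,B::=P\mid P\multimap A$. A typing context is a total map from variables to positive types with all but finitely many variables mapped to $[]$; it splits into its ground part $\Lambda$ (variables mapped to ground types) and its multiset part $\Gamma$; $\uplus$ is (pointwise) multiset union. $\mathrm{Nm}(\cdot)$ is the set of names occurring. Rules (premises $\Longrightarrow$ conclusion): - (i-sample) $\Lambda\vdash\mathsf{sample}_d:X$ if $X\notin\mathrm{Nm}(\Lambda)$. - (i-cond) $\Lambda,y_1:Y_1,\dots,y_n:Y_n\vdash\mathsf c\langle y_1,\dots,y_n\rangle:X$ if $X\notin\{Y_1,\dots,Y_n\}$ and $X\notin\mathrm{Nm}(\Lambda)$. - (i-var) $\Lambda,x:P\vdash x:P$. - (i-let) $\Lambda,\Gamma_1\vdash u:P$ and $\Lambda,\Gamma_2,x:P\vdash t:A$ $\Longrightarrow$ $\Lambda,\Gamma_1\uplus\Gamma_2\vdash\mathsf{let}\ x=u\ \mathsf{in}\ t:A$. - (i-pair) $\Lambda\vdash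 v:L_1$ and $\Lambda\vdash w:L_2$ $\Longrightarrow$ $\Lambda\vdash\langle v,w\rangle:L_1\otimes L_2$. - (i-letp) $\Lambda\vdash v:L_1\otimes L_2$ and $\Lambda,x:L_1,y:L_2,\Gamma\vdash t:A$ $\Longrightarrow$ $\Lambda,\Gamma\vdash\mathsf{letp}\ \langle x,y\rangle=v\ \mathsf{in}\ t:A$. - (i-abs) $\Lambda,\Gamma,x:P\vdash t:A$ $\Longrightarrow$ $\Lambda,\Gamma\vdash\lambda x.t:P\multimap A$. - (i-app) $\Lambda,\Gamma_1\vdash t:P\multimap A$ and $\Lambda,\Gamma_2\vdash v:P$ $\Longrightarrow$ $\Lambda,\Gamma_1\uplus\Gamma_2\vdash t\,v:A$. - (i-bang) $(\Lambda,\Gamma_i\vdash t:A_i)_{i=1}^n$, $n\ge0$ $\Longrightarrow$ $\Lambda,\biguplus_i\Gamma_i\vdash\,!t:[A_1,\dots,A_n]$. - (i-der) $\Lambda,\Gamma\vdash v:[A]$ $\Longrightarrow$ $\Lambda,\Gamma\vdash\mathsf{der}\,v:A$. Axioms (i-sample), (i-cond) are the *probabilistic axioms*; the name $X$ typing the subject is their *main name*. Naming condition (part of the definition of a derivation): main names are pairwise distinct. **Factors.** $\mathrm{Val}(X)=\{\mathtt t,\mathtt f\}$ for each name; $\mathrm{Val}(\mathbb X)=\prod_{X\in\mathbb X}\mathrm{Val}(X)$ for a finite set of names $\mathbb X$; $\bar x|_{\mathbb Y}$ is restriction. A factor over $\mathbb X$ is a function $\phi:\mathrm{Val}(\mathbb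 X)\to\mathbb R_{\ge0}$; $\mathrm{Nm}(\phi)=\mathbb X$. Sum out: for $\mathbb Z\subseteq\mathbb X$, $(\sum_{\mathbb Z}\phi)(\bar y)=\sum_{\bar z\in\mathrm{Val}(\mathbb Z)}\phi(\bar z\bar y)$, a factor over $\mathbb X-\mathbb Z$. Product: $(\phi_1\odot\phi_2)(\bar z)=\phi_1(\bar z|_{\mathrm{Nm}(\phi_1)})\,\phi_2(\bar z|_{\mathrm{Nm}(\phi_2)})$, a factor over $\mathrm{Nm}(\phi_1)\cup\mathrm{Nm}(\phi_2)$; the empty product is $\mathbf 1_\emptyset$, the factor over $\emptyset$ with value $1$. **Factors of axioms.** To $\Lambda\vdash\mathsf{sample}_d:X$ is associated the factor over $\{X\}$ with $\phi(x)=d(x)$; to an (i-cond) axiom $\Lambda,y_1:Y_1,\dots,y_n:Y_n\vdash\mathsf{case}\ \langle y_1,\dots,y_n\rangle\ \mathsf{of}\ \{\bar b\Rightarrow\mathsf{sample}_{d_{\bar b}}\}_{\bar b\in\{\mathtt t,\mathtt f\}^n}:X$ is associated the factor over $\mathbb Y\cup\{X\}$, $\mathbb Y=\{Y_1,\dots,Y_n\}$, with $\phi(\bar y\,x)=d_{\langle\bar y|_{Y_1},\dots,\bar y|_{Y_n}\rangle}(x)$. $\mathrm{Cpts}(\pi)$ is the family of factors associated with the probabilistic axioms of $\pi$; $\mathrm{Nm}(\mathrm{Cpts}(\pi))=\bigcup_{\phi\in\mathrm{Cpts}(\pi)}\mathrm{Nm}(\phi)$. -}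

module Defs where

open import Algebra.Bundles using (CommutativeSemiring)
open import Data.Bool.Base using (Bool; true; false)
open import Data.Fin.Base using (Fin)
open import Data.List.Base as List
  using (List; []; _∷_; _++_; length; foldr; filter; deduplicate)
open import Data.List.Membership.Propositional using (_∈_; _∉_)
open import Data.List.Membership.Propositional.Properties
  using (∈-++⁺ˡ; ∈-++⁺ʳ; ∈-deduplicate⁺; ∈-filter⁺; ∈-filter⁻)
open import Data.List.Relation.Binary.Permutation.Homogeneous using (Permutation)
open import Data.List.Relation.Binary.Permutation.Propositional using (_↭_)
open import Data.List.Relation.Binary.Subset.Propositional using (_⊆_)
open import Data.List.Relation.Unary.All as All using (All; []; _∷_)
open import Data.List.Relation.Unary.Any using (here)
open import Data.List.Relation.Unary.Unique.Propositional using (Unique)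
import Data.List.Relation.Unary.Unique.Propositional.Properties as Uniqueₚ
open import Data.Nat.Base using (ℕ; zero; suc; _+_)
open import Data.Nat.Properties using (_≟_)
open import Data.List.Membership.DecPropositional _≟_ using (_∈?_)
open import Data.List.Relation.Unary.Unique.DecPropositional.Properties _≟_
  using (deduplicate-!)
open import Data.Product.Base using (Σ; _×_; _,_; proj₁; proj₂)
open import Data.Vec.Base as Vec using (Vec; []; _∷_)
import Data.Vec.Membership.Propositional as VecMem
open import Data.Vec.Membership.Propositional.Properties using (∈-toList⁺)
open import Data.Vec.Relation.Binary.Pointwise.Inductive as Pointwise using (Pointwise)
open import Level using (Level; _⊔_)
open import Relation.Binary.PropositionalEquality using (_≡_; refl; trans; cong; cong₂)
open import Relation.Nullary.Decidable using (yes; no; ¬?)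

------------------------------------------------------------------------
-- Finite sets of names

Name : Set
Name = ℕ

record NameSet : Set where
  constructor _,!_
  field
    elems  : List Name
    unique : Unique elems

open NameSet public

∣_∣ : NameSet → ℕ
∣ 𝕏 ∣ = length (elems 𝕏)

fromList : List Name → NameSet
fromList Xs = deduplicate _≟_ Xs ,! deduplicate-! Xs

∅ : NameSet
∅ = fromList []

infixr 6 _∪_
_∪_ : NameSet → NameSet → NameSet
𝕏 ∪ 𝕐 = fromList (elems 𝕏 ++ elems 𝕐)

infixl 6 _─_
_─_ : NameSet → NameSet → NameSet
𝕏 ─ 𝕐 = filter (λ X → ¬? (X ∈? elems 𝕐)) (elems 𝕏)
     ,! Uniqueₚ.filter⁺ (λ X → ¬? (X ∈? elems 𝕐)) (unique 𝕏)

⊆-∪ˡ : ∀ 𝕏 𝕐 → elems 𝕏 ⊆ elems (𝕏 ∪ 𝕐)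
⊆-∪ˡ 𝕏 𝕐 X∈𝕏 = ∈-deduplicate⁺ _≟_ (∈-++⁺ˡ X∈𝕏)

⊆-∪ʳ : ∀ 𝕏 𝕐 → elems 𝕐 ⊆ elems (𝕏 ∪ 𝕐)
⊆-∪ʳ 𝕏 𝕐 Y∈𝕐 = ∈-deduplicate⁺ _≟_ (∈-++⁺ʳ (elems 𝕏) Y∈𝕐)

─-⊆ : ∀ 𝕏 𝕐 → elems (𝕏 ─ 𝕐) ⊆ elems 𝕏
─-⊆ 𝕏 𝕐 X∈ = proj₁ (∈-filter⁻ (λ X → ¬? (X ∈? elems 𝕐)) {xs = elems 𝕏} X∈)

------------------------------------------------------------------------
-- Valuations: Val(𝕏) is the product of the Val(X) = {t,f} for X in 𝕏

ValL : List Name → Set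
ValL = All (λ _ → Bool)

Val : NameSet → Set
Val 𝕏 = ValL (elems 𝕏)

restrict : ∀ {𝕏 𝕐} → elems 𝕐 ⊆ elems 𝕏 → Val 𝕏 → Val 𝕐
restrict 𝕐⊆𝕏 x̄ = All.tabulate (λ Y∈𝕐 → All.lookup x̄ (𝕐⊆𝕏 Y∈𝕐))

-- The tuple written z̄ȳ in the definition of sum out.
join : ∀ 𝕏 ℤ → Val ℤ → Val (𝕏 ─ ℤ) → Val 𝕏
join 𝕏 ℤ z̄ ȳ = All.tabulate pick
  where
  pick : ∀ {X} → X ∈ elems 𝕏 → Bool
  pick {X} X∈𝕏 with X ∈? elems ℤ
  ... | yes X∈ℤ = All.lookup z̄ X∈ℤ
  ... | no  X∉ℤ = All.lookup ȳ (∈-filter⁺ (λ X′ → ¬? (X′ ∈? elems ℤ)) X∈𝕏 X∉ℤ)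

------------------------------------------------------------------------
-- Intersection types

infixr 7 _⊗_
data GTy : Set where
  name : Name → GTy
  _⊗_  : GTy → GTy → GTy

infixr 6 _⊸_
mutual
  data PTy : Set where
    ground : GTy → PTy
    bag    : List Ty → PTy

  data Ty : Set where
    pos : PTy → Ty
    _⊸_ : PTy → Ty → Ty

-- A bag is a list; finite multisets are lists modulo permutation, at every
-- depth.  These relations are that quotient.
infix 4 _≈ᵖ_ _≈ᵗ_
mutual
  data _≈ᵖ_ : PTy → PTy → Set where
    ground : ∀ {L} → ground L ≈ᵖ ground L
    bag    : ∀ {As Bs} → Permutation _≈ᵗ_ As Bs → bag As ≈ᵖ bag Bs

  data _≈ᵗ_ : Ty → Ty → Set where
    pos : ∀ {P Q} → P ≈ᵖ Q → pos P ≈ᵗ pos Q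
    _⊸_ : ∀ {P Q A B} → P ≈ᵖ Q → A ≈ᵗ B → (P ⊸ A) ≈ᵗ (Q ⊸ B)

namesᵍ : GTy → List Name
namesᵍ (name X) = X ∷ []
namesᵍ (K ⊗ L)  = namesᵍ K ++ namesᵍ L

mutual
  namesᵖ : PTy → List Name
  namesᵖ (ground L) = namesᵍ L
  namesᵖ (bag As)   = namesᵇ As

  namesᵇ : List Ty → List Name
  namesᵇ []       = []
  namesᵇ (A ∷ As) = namesᵗ A ++ namesᵇ As

  namesᵗ : Ty → List Name
  namesᵗ (pos P) = namesᵖ P
  namesᵗ (P ⊸ A) = namesᵖ P ++ namesᵗ A

------------------------------------------------------------------------
-- Typing contexts.  Variables are de Bruijn indices; every variable outside
-- the scope k is implicitly mapped to the empty multiset.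

Ctx : ℕ → Set
Ctx k = Vec PTy k

namesᶜ : ∀ {k} → Ctx k → List Name
namesᶜ []      = []
namesᶜ (P ∷ Δ) = namesᵖ P ++ namesᶜ Δ

-- A context is "ground" (written Λ) when its multiset part is empty.
data IsGroundᵖ : PTy → Set where
  ground : ∀ {L} → IsGroundᵖ (ground L)
  empty  : IsGroundᵖ (bag [])

IsGround : ∀ {k} → Ctx k → Set
IsGround {k} Λ = ∀ (x : Fin k) → IsGroundᵖ (Vec.lookup Λ x)

groundPartᵖ : PTy → PTy
groundPartᵖ (ground L) = ground L
groundPartᵖ (bag _)    = bag []

groundPart : ∀ {k} → Ctx k → Ctx k
groundPart = Vec.map groundPartᵖ

-- Δ₁ ⊎ Δ₂ ≔ Δ: for some Λ, the three contexts are Λ,Γ₁ and Λ,Γ₂ and Λ,Γ₁⊎Γ₂.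
data _⊎ᵖ_≔_ : PTy → PTy → PTy → Set where
  ground : ∀ {L} → ground L ⊎ᵖ ground L ≔ ground L
  bag    : ∀ {As Bs} → bag As ⊎ᵖ bag Bs ≔ bag (As ++ Bs)

infix 4 _⊎_≔_
_⊎_≔_ : ∀ {k} → Ctx k → Ctx k → Ctx k → Set
_⊎_≔_ {k} Δ₁ Δ₂ Δ =
  ∀ (x : Fin k) → Vec.lookup Δ₁ x ⊎ᵖ Vec.lookup Δ₂ x ≔ Vec.lookup Δ x

------------------------------------------------------------------------
-- Computations that count elementary arithmetic operations

record Counted {a} (A : Set a) : Set a where
  constructor _▹_
  field
    ops    : ℕ
    result : A

open Counted public

module _ {a b : Level} {A : Set a} {B : Set b} where

  infixl 1 _>>=_
  _>>=_ : Counted A → (A → Counted B) → Counted B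
  m >>= f = (ops m + ops (f (result m))) ▹ result (f (result m))

return : ∀ {a} {A : Set a} → A → Counted A
return x = 0 ▹ x

-- Computing a table means computing each of its entries; reading an entry of
-- the resulting table is free.
opsOfTable : ∀ {a} {A : Set a} Xs → (ValL Xs → Counted A) → ℕ
opsOfTable []       f = ops (f [])
opsOfTable (X ∷ Xs) f =
  opsOfTable Xs (λ x̄ → f (true ∷ x̄)) + opsOfTable Xs (λ x̄ → f (false ∷ x̄))

tableᶜ : ∀ {a} {A : Set a} 𝕏 → (Val 𝕏 → Counted A) → Counted (Val 𝕏 → A)
tableᶜ 𝕏 f = opsOfTable (elems 𝕏) f ▹ (λ x̄ → result (f x̄))

------------------------------------------------------------------------
-- The calculus, its derivations and their interpretation.  The commutative
-- semiring R plays the role of the nonnegative reals: everything below uses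
-- only its addition and multiplication.

module Model {c ℓ : Level} (R : CommutativeSemiring c ℓ) where

  open CommutativeSemiring R
    renaming (Carrier to Scalar; _+_ to _+ᴿ_; _*_ to _*ᴿ_)
    using (_≈_; 1#)

  record Dist : Set (c ⊔ ℓ) where
    field
      pr     : Bool → Scalar
      pr-sum : (pr true +ᴿ pr false) ≈ 1#

  open Dist public

  ----------------------------------------------------------------------
  -- Terms, with de Bruijn indices for α-equivalence

  mutual
    data Term (k : ℕ) : Set (c ⊔ ℓ) where
      val     : Value k → Term k
      sample  : Dist → Term k
      case_of_ : Value k → List (Value k × Dist) → Term k
      obs     : Fin k → Bool → Term k
      let-in  : Term k → Term (suc k) → Term k
      -- letp ⟨x,y⟩ = v in t: in t, x is index 1 and y is index 0.
      letp-in : Value k → Term (suc (suc k)) → Term k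
      _·_     : Term k → Value k → Term k
      ƛ_      : Term (suc k) → Term k
      der     : Value k → Term k

    data Value (k : ℕ) : Set (c ⊔ ℓ) where
      var   : Fin k → Value k
      ⟨_,_⟩ : Value k → Value k → Value k
      !_    : Term k → Value k
      bool  : Bool → Value k

  -- ⟨v₁,…,vₙ⟩, n ≥ 1, from binary pairs, nested to the right.
  tuple : ∀ {k n} → Vec (Value k) (suc n) → Value k
  tuple (v ∷ [])     = v
  tuple (v ∷ w ∷ vs) = ⟨ v , tuple (w ∷ vs) ⟩

  boolVecs : ∀ n → List (Vec Bool n)
  boolVecs zero    = [] ∷ []
  boolVecs (suc n) =
    List.map (true ∷_) (boolVecs n) ++ List.map (false ∷_) (boolVecs n)

  branches : ∀ {k n} → (Vec Bool (suc n) → Dist) → List (Value k × Dist)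
  branches d = List.map (λ b̄ → tuple (Vec.map bool b̄) , d b̄) (boolVecs _)

  ----------------------------------------------------------------------
  -- Derivations

  nameTy : Name → Ty
  nameTy X = pos (ground (name X))

  infix 3 _⊢_∶_ _⊢!_∶_
  mutual
    data _⊢_∶_ {k : ℕ} : Ctx k → Term k → Ty → Set (c ⊔ ℓ) where

      i-sample : ∀ {Λ} (d : Dist) (X : Name) →
        IsGround Λ → X ∉ namesᶜ Λ →
        Λ ⊢ sample d ∶ nameTy X

      -- Here Λ is the whole context y₁:Y₁,…,yₙ:Yₙ included, so that
      -- X ∉ namesᶜ Λ contains the condition X ∉ {Y₁,…,Yₙ}.  The branches
      -- form an unordered family.  The yᵢ need not be distinct variables, so that
      -- c⟨y,y⟩ is typable when y is substituted for x in c⟨x,y⟩.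
      i-cond : ∀ {Λ n bs} (ys : Vec (Fin k) (suc n)) (Ys : Vec Name (suc n))
        (d : Vec Bool (suc n) → Dist) (X : Name) →
        IsGround Λ →
        (∀ i → Vec.lookup Λ (Vec.lookup ys i) ≡ ground (name (Vec.lookup Ys i))) →
        X ∉ namesᶜ Λ →
        bs ↭ branches d →
        Λ ⊢ case tuple (Vec.map var ys) of bs ∶ nameTy X

      -- The context Λ,x:P where P may be a nonempty multiset.
      i-var : ∀ {Δ P} (x : Fin k) →
        Vec.lookup Δ x ≡ P → IsGround (Δ Vec.[ x ]≔ bag []) →
        Δ ⊢ val (var x) ∶ pos P

      i-let : ∀ {Δ₁ Δ₂ Δ u t P A} →
        Δ₁ ⊢ u ∶ pos P → P ∷ Δ₂ ⊢ t ∶ A → Δ₁ ⊎ Δ₂ ≔ Δ →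
        Δ ⊢ let-in u t ∶ A

      i-pair : ∀ {Λ v w L₁ L₂} → IsGround Λ →
        Λ ⊢ val v ∶ pos (ground L₁) → Λ ⊢ val w ∶ pos (ground L₂) →
        Λ ⊢ val ⟨ v , w ⟩ ∶ pos (ground (L₁ ⊗ L₂))

      i-letp : ∀ {Δ v t L₁ L₂ A} →
        groundPart Δ ⊢ val v ∶ pos (ground (L₁ ⊗ L₂)) →
        ground L₂ ∷ ground L₁ ∷ Δ ⊢ t ∶ A →
        Δ ⊢ letp-in v t ∶ A

      i-abs : ∀ {Δ t P A} →
        P ∷ Δ ⊢ t ∶ A →
        Δ ⊢ ƛ t ∶ P ⊸ A

      i-app : ∀ {Δ₁ Δ₂ Δ t v P A} →
        Δ₁ ⊢ t ∶ P ⊸ A → Δ₂ ⊢ val v ∶ pos P → Δ₁ ⊎ Δ₂ ≔ Δ →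
        Δ ⊢ t · v ∶ A

      i-bang : ∀ {Δ t As} →
        Δ ⊢! t ∶ As →
        Δ ⊢ val (! t) ∶ pos (bag As)

      i-der : ∀ {Δ v A} →
        Δ ⊢ val v ∶ pos (bag (A ∷ [])) →
        Δ ⊢ der v ∶ A

      -- Not a logical rule: judgments are taken modulo reordering of multisets.
      conv : ∀ {Δ Δ′ t A A′} →
        Pointwise _≈ᵖ_ Δ Δ′ → A ≈ᵗ A′ → Δ ⊢ t ∶ A →
        Δ′ ⊢ t ∶ A′

    -- The family of n ≥ 0 premises of i-bang.
    data _⊢!_∶_ {k : ℕ} : Ctx k → Term k → List Ty → Set (c ⊔ ℓ) where
      []  : ∀ {Λ t} → IsGround Λ → Λ ⊢! t ∶ []
      _∷_ : ∀ {Δ₁ Δ₂ Δ t A As} →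
        Δ₁ ⊢ t ∶ A × Δ₁ ⊎ Δ₂ ≔ Δ → Δ₂ ⊢! t ∶ As →
        Δ ⊢! t ∶ A ∷ As

  data ProbAxiom : Set (c ⊔ ℓ) where
    sample : Dist → Name → ProbAxiom
    cond   : ∀ {n} → Vec Name (suc n) → (Vec Bool (suc n) → Dist) → Name → ProbAxiom

  mainName : ProbAxiom → Name
  mainName (sample d X)  = X
  mainName (cond Ys d X) = X

  mutual
    axioms : ∀ {k} {Δ : Ctx k} {t A} → Δ ⊢ t ∶ A → List ProbAxiom
    axioms (i-sample d X _ _)         = sample d X ∷ []
    axioms (i-cond ys Ys d X _ _ _ _) = cond Ys d X ∷ []
    axioms (i-var _ _ _)              = []
    axioms (i-let ρ σ _)              = axioms ρ ++ axioms σ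
    axioms (i-pair _ ρ σ)             = axioms ρ ++ axioms σ
    axioms (i-letp ρ σ)               = axioms ρ ++ axioms σ
    axioms (i-abs ρ)                  = axioms ρ
    axioms (i-app ρ σ _)              = axioms ρ ++ axioms σ
    axioms (i-bang ρs)                = axioms! ρs
    axioms (i-der ρ)                  = axioms ρ
    axioms (conv _ _ ρ)               = axioms ρ

    axioms! : ∀ {k} {Δ : Ctx k} {t As} → Δ ⊢! t ∶ As → List ProbAxiom
    axioms! ([] _)         = []
    axioms! ((ρ , _) ∷ ρs) = axioms ρ ++ axioms! ρs

  record Derivation {k} (Δ : Ctx k) (t : Term k) (A : Ty) : Set (c ⊔ ℓ) where
    field
      tree   : Δ ⊢ t ∶ A
      naming : Unique (List.map mainName (axioms tree))

  open Derivation public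

  ----------------------------------------------------------------------
  -- Factors

  Factor : NameSet → Set c
  Factor 𝕏 = Val 𝕏 → Scalar

  NamedFactor : Set c
  NamedFactor = Σ NameSet Factor

  Nm : NamedFactor → NameSet
  Nm = proj₁

  𝟏∅ : Factor ∅
  𝟏∅ _ = 1#

  infixr 7 _⊙_
  _⊙_ : ∀ {𝕏 𝕐} → Factor 𝕏 → Factor 𝕐 → Factor (𝕏 ∪ 𝕐)
  _⊙_ {𝕏} {𝕐} φ ψ z̄ =
    φ (restrict {𝕏 ∪ 𝕐} {𝕏} (⊆-∪ˡ 𝕏 𝕐) z̄) *ᴿ ψ (restrict {𝕏 ∪ 𝕐} {𝕐} (⊆-∪ʳ 𝕏 𝕐) z̄)

  ⋃Nm : List NamedFactor → NameSet
  ⋃Nm = foldr (λ φ 𝕏 → Nm φ ∪ 𝕏) ∅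

  ⨀ : (φs : List NamedFactor) → Factor (⋃Nm φs)
  ⨀ []             = 𝟏∅
  ⨀ ((𝕏 , φ) ∷ φs) = _⊙_ {𝕏} {⋃Nm φs} φ (⨀ φs)

  sumVal : ∀ Zs → (ValL Zs → Scalar) → Scalar
  sumVal []       f = f []
  sumVal (Z ∷ Zs) f = sumVal Zs (λ z̄ → f (true ∷ z̄)) +ᴿ sumVal Zs (λ z̄ → f (false ∷ z̄))

  sumOut : ∀ 𝕏 ℤ → elems ℤ ⊆ elems 𝕏 → Factor 𝕏 → Factor (𝕏 ─ ℤ)
  sumOut 𝕏 ℤ _ φ ȳ = sumVal (elems ℤ) (λ z̄ → φ (join 𝕏 ℤ z̄ ȳ))

  factor : ProbAxiom → NamedFactor
  factor (sample d X) = fromList (X ∷ []) , λ { (x ∷ []) → pr d x }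
  factor (cond Ys d X) = 𝕐 ∪ 𝕏 , λ z̄ →
      pr (d (VecMem.mapWith∈ Ys (λ Y∈ → All.lookup z̄ (⊆-∪ˡ 𝕐 𝕏 (∈-deduplicate⁺ _≟_ (∈-toList⁺ Y∈))))))
         (All.lookup z̄ (⊆-∪ʳ 𝕐 𝕏 (here refl)))
    where
    𝕐 = fromList (Vec.toList Ys)
    𝕏 = fromList (X ∷ [])

  module _ {k} {Δ : Ctx k} {t A} (π : Derivation Δ t A) where

    Cpts : List NamedFactor
    Cpts = List.map factor (axioms (tree π))

    numAxioms : ℕ
    numAxioms = length (axioms (tree π))

    NmCpts : NameSet
    NmCpts = ⋃Nm Cpts

    NmJudgment : NameSet
    NmJudgment = fromList (namesᶜ Δ ++ namesᵗ A)

    hidden : NameSet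
    hidden = NmCpts ─ NmJudgment

    ⟦_⟧ : Factor (NmCpts ─ hidden)
    ⟦_⟧ = sumOut NmCpts hidden (─-⊆ NmCpts NmJudgment) (⨀ Cpts)

  ----------------------------------------------------------------------
  -- The same operations, counting arithmetic

  _+ᶜ_ _*ᶜ_ : Scalar → Scalar → Counted Scalar
  x +ᶜ y = 1 ▹ (x +ᴿ y)
  x *ᶜ y = 1 ▹ (x *ᴿ y)

  _⊙ᶜ_ : ∀ {𝕏 𝕐} → Factor 𝕏 → Factor 𝕐 → Counted (Factor (𝕏 ∪ 𝕐))
  _⊙ᶜ_ {𝕏} {𝕐} φ ψ = tableᶜ (𝕏 ∪ 𝕐) λ z̄ →
    φ (restrict {𝕏 ∪ 𝕐} {𝕏} (⊆-∪ˡ 𝕏 𝕐) z̄) *ᶜ ψ (restrict {𝕏 ∪ 𝕐} {𝕐} (⊆-∪ʳ 𝕏 𝕐) z̄)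

  -- A product by 𝟏∅ costs nothing.
  ⨀ᶜ : (φs : List NamedFactor) → Counted (Factor (⋃Nm φs))
  ⨀ᶜ []                       = return 𝟏∅
  ⨀ᶜ ((𝕏 , φ) ∷ [])           = return (_⊙_ {𝕏} {∅} φ 𝟏∅)
  ⨀ᶜ ((𝕏 , φ) ∷ φs@(_ ∷ _)) = ⨀ᶜ φs >>= λ ψ → _⊙ᶜ_ {𝕏} {⋃Nm φs} φ ψ

  sumValᶜ : ∀ Zs → (ValL Zs → Scalar) → Counted Scalar
  sumValᶜ []       f = return (f [])
  sumValᶜ (Z ∷ Zs) f =
    sumValᶜ Zs (λ z̄ → f (true ∷ z̄)) >>= λ x →
    sumValᶜ Zs (λ z̄ → f (false ∷ z̄)) >>= λ y →
    x +ᶜ y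

  sumOutᶜ : ∀ 𝕏 ℤ → elems ℤ ⊆ elems 𝕏 → Factor 𝕏 → Counted (Factor (𝕏 ─ ℤ))
  sumOutᶜ 𝕏 ℤ _ φ = tableᶜ (𝕏 ─ ℤ) λ ȳ → sumValᶜ (elems ℤ) (λ z̄ → φ (join 𝕏 ℤ z̄ ȳ))

  module _ {k} {Δ : Ctx k} {t A} (π : Derivation Δ t A) where

    ⟦_⟧ᶜ : Counted (Factor (NmCpts π ─ hidden π))
    ⟦_⟧ᶜ = ⨀ᶜ (Cpts π) >>= sumOutᶜ (NmCpts π) (hidden π) (─-⊆ (NmCpts π) (NmJudgment π))

    cost : ℕ
    cost = ops ⟦_⟧ᶜ

  -- The counted computation does compute ⟦π⟧.

  ⨀ᶜ-result : ∀ φs → result (⨀ᶜ φs) ≡ ⨀ φs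
  ⨀ᶜ-result []                       = refl
  ⨀ᶜ-result (_ ∷ [])                 = refl
  ⨀ᶜ-result ((𝕏 , φ) ∷ φs@(_ ∷ _)) = cong (λ ψ → _⊙_ {𝕏} {⋃Nm φs} φ ψ) (⨀ᶜ-result φs)

  sumValᶜ-result : ∀ Zs f → result (sumValᶜ Zs f) ≡ sumVal Zs f
  sumValᶜ-result []       f = refl
  sumValᶜ-result (Z ∷ Zs) f = cong₂ _+ᴿ_ (sumValᶜ-result Zs _) (sumValᶜ-result Zs _)

  ⟦⟧ᶜ-result : ∀ {k} {Δ : Ctx k} {t A} (π : Derivation Δ t A) ȳ →
    result ⟦ π ⟧ᶜ ȳ ≡ ⟦ π ⟧ ȳ
  ⟦⟧ᶜ-result π ȳ = trans
    (sumValᶜ-result (elems (hidden π)) _)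
    (cong (λ φ → sumOut (NmCpts π) (hidden π) (─-⊆ (NmCpts π) (NmJudgment π)) φ ȳ)
          (⨀ᶜ-result (Cpts π)))

{-# OPTIONS --safe #-}
-- The main names are m_π distinct names, each occurring in the factor of its
-- axiom; hence m_π ≤ n.  For the cost, the full product of m_π ≥ 1 factors takes
-- m_π − 1 binary products, each entrywise over at most n names, so at most
-- (m_π − 1) 2ⁿ multiplications; summing out ℤ from 𝕏 costs 2^∣𝕏 − ℤ∣ (2^∣ℤ∣ − 1) ≤ 2ⁿ
-- additions.  If m_π = 0, there is nothing to sum out and the cost is 0.  Hence the
-- constant can be taken to be 1.
module Submission where

open import Defs
open import Algebra.Bundles using (CommutativeSemiring)
open import Data.Bool.Base using (true; false)
open import Data.Fin.Base using (Fin; zero; suc)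
open import Data.Fin.Properties using (injective⇒≤)
open import Data.List.Base using (List; []; _∷_; _++_; length; lookup; map)
open import Data.List.Membership.Propositional using (_∈_)
open import Data.List.Membership.Propositional.Properties
  using (∈-lookup; ∈-++⁻; ∈-filter⁻; ∈-map⁻; ∈-map⁺)
open import Data.List.Properties using (length-++; length-map)
open import Data.List.Relation.Binary.Subset.Propositional using (_⊆_)
open import Data.List.Relation.Unary.All as All using ([]; _∷_)
open import Data.List.Relation.Unary.AllPairs using ([]; _∷_)
open import Data.List.Relation.Unary.Any using (here; there; index)
open import Data.List.Relation.Unary.Any.Properties using (lookup-index)
open import Data.List.Relation.Unary.Unique.Propositional using (Unique)
import Data.List.Relation.Unary.Unique.Propositional.Properties as Uniqueₚ
open import Data.Nat.Base using (ℕ; suc; _≤_; z≤n; _+_; _*_; _^_)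
open import Data.Nat.Properties
  using (_≟_; ≤-refl; ≤-reflexive; ≤-trans; <⇒≤; +-comm; +-identityʳ; +-mono-≤;
         +-monoˡ-≤; *-identityˡ; *-identityʳ; *-distribʳ-+; *-monoʳ-≤; ^-monoʳ-≤;
         ^-distribˡ-+-*; module ≤-Reasoning)
open import Data.List.Membership.DecPropositional _≟_ using (_∈?_)
open import Data.Product.Base using (_×_; _,_; proj₂; ∃-syntax)
open import Data.Sum.Base using ([_,_])
import Data.Vec.Base as Vec
open import Function.Base using (_∘_)
open import Function.Definitions using (Injective)
open import Relation.Binary.PropositionalEquality
  using (_≡_; refl; sym; cong; cong₂; subst; module ≡-Reasoning)
open import Relation.Nullary.Decidable using (¬?)
open import Relation.Nullary.Negation using (contradiction)

Unique⇒lookup-injective : ∀ {a} {A : Set a} {xs : List A} →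
  Unique xs → Injective _≡_ _≡_ (lookup xs)
Unique⇒lookup-injective (_ ∷ _)     {zero}  {zero}  _  = refl
Unique⇒lookup-injective (x∉xs ∷ _)  {zero}  {suc j} eq =
  contradiction eq (All.lookup x∉xs (∈-lookup j))
Unique⇒lookup-injective (x∉xs ∷ _)  {suc i} {zero}  eq =
  contradiction (sym eq) (All.lookup x∉xs (∈-lookup i))
Unique⇒lookup-injective (_ ∷ xs!)   {suc i} {suc j} eq =
  cong suc (Unique⇒lookup-injective xs! eq)

-- Pigeonhole principle: sending each index of `xs` to the position in `ys` of an occurrence of its
-- entry is injective, since the position determines the entry and, without repetitions, the entry
-- determines the index.
Unique-⊆⇒length≤ : ∀ {a} {A : Set a} {xs ys : List A} →
  Unique xs → xs ⊆ ys → length xs ≤ length ys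
Unique-⊆⇒length≤ {xs = xs} {ys} xs! xs⊆ys = injective⇒≤ position-injective
  where
  position : Fin (length xs) → Fin (length ys)
  position i = index (xs⊆ys (∈-lookup i))

  position-injective : Injective _≡_ _≡_ position
  position-injective {i} {j} eq = Unique⇒lookup-injective xs! (begin
    lookup xs i            ≡⟨ lookup-index (xs⊆ys (∈-lookup i)) ⟩
    lookup ys (position i) ≡⟨ cong (lookup ys) eq ⟩
    lookup ys (position j) ≡⟨ lookup-index (xs⊆ys (∈-lookup j)) ⟨
    lookup xs j            ∎)
    where open ≡-Reasoning

∣∪∣-monoʳ : ∀ 𝕏 𝕐 → ∣ 𝕐 ∣ ≤ ∣ 𝕏 ∪ 𝕐 ∣
∣∪∣-monoʳ 𝕏 𝕐 = Unique-⊆⇒length≤ (unique 𝕐) (⊆-∪ʳ 𝕏 𝕐)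

-- `𝕏 ─ ℤ` and `ℤ` are disjoint, so their concatenation has no repetitions and the counting bound
-- for subsets of `𝕏` applies to it.
∣─∣+∣∣≤∣∣ : ∀ 𝕏 ℤ → elems ℤ ⊆ elems 𝕏 → ∣ 𝕏 ─ ℤ ∣ + ∣ ℤ ∣ ≤ ∣ 𝕏 ∣
∣─∣+∣∣≤∣∣ 𝕏 ℤ ℤ⊆𝕏 = begin
  ∣ 𝕏 ─ ℤ ∣ + ∣ ℤ ∣                ≡⟨ length-++ (elems (𝕏 ─ ℤ)) ⟨
  length (elems (𝕏 ─ ℤ) ++ elems ℤ) ≤⟨ Unique-⊆⇒length≤ disjointUnion! disjointUnion⊆𝕏 ⟩
  ∣ 𝕏 ∣                            ∎
  where
  open ≤-Reasoning

  disjointUnion! : Unique (elems (𝕏 ─ ℤ) ++ elems ℤ)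
  disjointUnion! = Uniqueₚ.++⁺ (unique (𝕏 ─ ℤ)) (unique ℤ)
    λ (X∈𝕏─ℤ , X∈ℤ) →
      proj₂ (∈-filter⁻ (λ X → ¬? (X ∈? elems ℤ)) {xs = elems 𝕏} X∈𝕏─ℤ) X∈ℤ

  disjointUnion⊆𝕏 : elems (𝕏 ─ ℤ) ++ elems ℤ ⊆ elems 𝕏
  disjointUnion⊆𝕏 = [ ─-⊆ 𝕏 ℤ , ℤ⊆𝕏 ] ∘ ∈-++⁻ (elems (𝕏 ─ ℤ))

2^suc : ∀ n → 2 ^ suc n ≡ 2 ^ n + 2 ^ n
2^suc n = cong (2 ^ n +_) (+-identityʳ (2 ^ n))

opsOfTable-≤ : ∀ {a} {A : Set a} Xs (f : ValL Xs → Counted A) {b} →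
  (∀ x̄ → ops (f x̄) ≤ b) → opsOfTable Xs f ≤ 2 ^ length Xs * b
opsOfTable-≤ []       f {b} f≤b = ≤-trans (f≤b []) (≤-reflexive (sym (*-identityˡ b)))
opsOfTable-≤ (X ∷ Xs) f {b} f≤b = begin
  opsOfTable Xs (λ x̄ → f (true ∷ x̄)) + opsOfTable Xs (λ x̄ → f (false ∷ x̄))
    ≤⟨ +-mono-≤ (opsOfTable-≤ Xs _ (λ x̄ → f≤b (true ∷ x̄)))
                (opsOfTable-≤ Xs _ (λ x̄ → f≤b (false ∷ x̄))) ⟩
  2 ^ length Xs * b + 2 ^ length Xs * b ≡⟨ *-distribʳ-+ b (2 ^ length Xs) _ ⟨
  (2 ^ length Xs + 2 ^ length Xs) * b   ≡⟨ cong (_* b) (2^suc (length Xs)) ⟨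
  2 ^ suc (length Xs) * b               ∎
  where open ≤-Reasoning

module _ {c ℓ} (R : CommutativeSemiring c ℓ) where
  open Model R

  mainName∈Nm : ∀ α → mainName α ∈ elems (Nm (factor α))
  mainName∈Nm (sample d X)  = here refl
  mainName∈Nm (cond Ys d X) = ⊆-∪ʳ (fromList (Vec.toList Ys)) (fromList (X ∷ [])) (here refl)

  Nm⊆⋃Nm : ∀ {φ φs} → φ ∈ φs → elems (Nm φ) ⊆ elems (⋃Nm φs)
  Nm⊆⋃Nm {φs = ψ ∷ φs} (here refl) X∈ = ⊆-∪ˡ (Nm ψ) (⋃Nm φs) X∈
  Nm⊆⋃Nm {φs = ψ ∷ φs} (there φ∈)  X∈ = ⊆-∪ʳ (Nm ψ) (⋃Nm φs) (Nm⊆⋃Nm φ∈ X∈)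

  numAxioms≤∣NmCpts∣ : ∀ {k} {Δ : Ctx k} {t A} (π : Derivation Δ t A) →
    numAxioms π ≤ ∣ NmCpts π ∣
  numAxioms≤∣NmCpts∣ π = begin
    numAxioms π                                ≡⟨ length-map mainName (axioms (tree π)) ⟨
    -- The naming condition enters here: distinct axioms contribute distinct names.
    length (map mainName (axioms (tree π)))    ≤⟨ Unique-⊆⇒length≤ (naming π) mainNames⊆ ⟩
    ∣ NmCpts π ∣                               ∎
    where
    open ≤-Reasoning

    mainNames⊆ : map mainName (axioms (tree π)) ⊆ elems (NmCpts π)
    mainNames⊆ X∈ with α , α∈ , refl ← ∈-map⁻ mainName X∈ =
      Nm⊆⋃Nm (∈-map⁺ factor α∈) (mainName∈Nm α)

  ops-⊙ᶜ-≤ : ∀ 𝕏 𝕐 (φ : Factor 𝕏) (ψ : Factor 𝕐) → ops (_⊙ᶜ_ {𝕏} {𝕐} φ ψ) ≤ 2 ^ ∣ 𝕏 ∪ 𝕐 ∣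
  ops-⊙ᶜ-≤ 𝕏 𝕐 φ ψ = ≤-trans
    -- Each entry takes a single multiplication, so the bound per entry is 1.
    (opsOfTable-≤ (elems (𝕏 ∪ 𝕐)) _ (λ _ → ≤-refl))
    (≤-reflexive (*-identityʳ _))

  -- Counting only the factors after the first matters: the last factor meets just the trivial
  -- factor, which is free, and the product thus saved later pays for the sum out.
  ops-⨀ᶜ-≤ : ∀ φ φs → ops (⨀ᶜ (φ ∷ φs)) ≤ length φs * 2 ^ ∣ ⋃Nm (φ ∷ φs) ∣
  ops-⨀ᶜ-≤ φ       []       = z≤n
  ops-⨀ᶜ-≤ (𝕏 , φ) (ψ ∷ ψs) = begin
    ops (⨀ᶜ (ψ ∷ ψs)) + ops (_⊙ᶜ_ {𝕏} {𝕐} φ (result (⨀ᶜ (ψ ∷ ψs))))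
      ≤⟨ +-mono-≤ (ops-⨀ᶜ-≤ ψ ψs) (ops-⊙ᶜ-≤ 𝕏 𝕐 φ (result (⨀ᶜ (ψ ∷ ψs)))) ⟩
    length ψs * 2 ^ ∣ 𝕐 ∣ + 2 ^ ∣ 𝕏 ∪ 𝕐 ∣
      -- Every intermediate table is charged as if it ranged over all names of the final product.
      ≤⟨ +-monoˡ-≤ _ (*-monoʳ-≤ (length ψs) (^-monoʳ-≤ 2 (∣∪∣-monoʳ 𝕏 𝕐))) ⟩
    length ψs * 2 ^ ∣ 𝕏 ∪ 𝕐 ∣ + 2 ^ ∣ 𝕏 ∪ 𝕐 ∣
      ≡⟨ +-comm (length ψs * _) _ ⟩
    suc (length ψs) * 2 ^ ∣ 𝕏 ∪ 𝕐 ∣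
      ∎
    where
    open ≤-Reasoning
    𝕐 = ⋃Nm (ψ ∷ ψs)

  -- Adding up N values takes N - 1 additions; the `suc` avoids truncated subtraction.
  ops-sumValᶜ : ∀ Zs f → suc (ops (sumValᶜ Zs f)) ≡ 2 ^ length Zs
  ops-sumValᶜ []       f = refl
  ops-sumValᶜ (Z ∷ Zs) f = begin
    -- The addition that joins the two halves provides the second `suc`, so the induction hypothesis
    -- applies to both.
    suc (ops₁ + (ops₂ + 1))       ≡⟨ cong (λ n → suc (ops₁ + n)) (+-comm ops₂ 1) ⟩
    suc ops₁ + suc ops₂           ≡⟨ cong₂ _+_ (ops-sumValᶜ Zs _) (ops-sumValᶜ Zs _) ⟩
    2 ^ length Zs + 2 ^ length Zs ≡⟨ 2^suc (length Zs) ⟨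
    2 ^ suc (length Zs)           ∎
    where
    open ≡-Reasoning
    ops₁ = ops (sumValᶜ Zs (λ z̄ → f (true ∷ z̄)))
    ops₂ = ops (sumValᶜ Zs (λ z̄ → f (false ∷ z̄)))

  ops-sumOutᶜ-≤ : ∀ 𝕏 ℤ (ℤ⊆𝕏 : elems ℤ ⊆ elems 𝕏) φ →
    ops (sumOutᶜ 𝕏 ℤ ℤ⊆𝕏 φ) ≤ 2 ^ ∣ 𝕏 ∣
  ops-sumOutᶜ-≤ 𝕏 ℤ ℤ⊆𝕏 φ = begin
    ops (sumOutᶜ 𝕏 ℤ ℤ⊆𝕏 φ)
      -- The exact count of additions per entry, one less than `2 ^ ∣ ℤ ∣`, is rounded up.
      ≤⟨ opsOfTable-≤ (elems (𝕏 ─ ℤ)) _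
           (λ _ → <⇒≤ (≤-reflexive (ops-sumValᶜ (elems ℤ) _))) ⟩
    2 ^ ∣ 𝕏 ─ ℤ ∣ * 2 ^ ∣ ℤ ∣ ≡⟨ ^-distribˡ-+-* 2 ∣ 𝕏 ─ ℤ ∣ ∣ ℤ ∣ ⟨
    2 ^ (∣ 𝕏 ─ ℤ ∣ + ∣ ℤ ∣)   ≤⟨ ^-monoʳ-≤ 2 (∣─∣+∣∣≤∣∣ 𝕏 ℤ ℤ⊆𝕏) ⟩
    2 ^ ∣ 𝕏 ∣                 ∎
    where open ≤-Reasoning

  -- Stated for an arbitrary list of factors, with `𝕁` the names to keep, so that one can split on
  -- whether the list is empty.
  ops-⨀ᶜ-sumOutᶜ-≤ : ∀ φs 𝕁 →
    let 𝕏 = ⋃Nm φs in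
    ops (⨀ᶜ φs >>= sumOutᶜ 𝕏 (𝕏 ─ 𝕁) (─-⊆ 𝕏 𝕁)) ≤ length φs * 2 ^ ∣ 𝕏 ∣
  -- Without factors there are no names: the only table has one entry, an empty iteration of sums,
  -- and the cost computes to 0.
  ops-⨀ᶜ-sumOutᶜ-≤ []       𝕁 = z≤n
  ops-⨀ᶜ-sumOutᶜ-≤ (φ ∷ φs) 𝕁 = begin
    ops (⨀ᶜ (φ ∷ φs)) + ops (sumOutᶜ 𝕏 (𝕏 ─ 𝕁) (─-⊆ 𝕏 𝕁) (result (⨀ᶜ (φ ∷ φs))))
      ≤⟨ +-mono-≤ (ops-⨀ᶜ-≤ φ φs) (ops-sumOutᶜ-≤ 𝕏 (𝕏 ─ 𝕁) (─-⊆ 𝕏 𝕁) (result (⨀ᶜ (φ ∷ φs)))) ⟩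
    -- The sum out takes the place of the one product saved.
    length φs * 2 ^ ∣ 𝕏 ∣ + 2 ^ ∣ 𝕏 ∣ ≡⟨ +-comm (length φs * _) _ ⟩
    suc (length φs) * 2 ^ ∣ 𝕏 ∣       ∎
    where
    open ≤-Reasoning
    𝕏 = ⋃Nm (φ ∷ φs)

  cost-≤ : ∀ {k} {Δ : Ctx k} {t A} (π : Derivation Δ t A) →
    cost π ≤ numAxioms π * 2 ^ ∣ NmCpts π ∣
  cost-≤ π = subst (λ m → cost π ≤ m * 2 ^ ∣ NmCpts π ∣)
    (length-map factor (axioms (tree π)))
    (ops-⨀ᶜ-sumOutᶜ-≤ (Cpts π) (NmJudgment π))

proposition9p1 : ∀ {c ℓ} (R : CommutativeSemiring c ℓ) →
    let open Model R in
    (∀ {k} {Λ : Ctx k} {t : Term k} {L : GTy} → IsGround Λ →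
    (π : Derivation Λ t (pos (ground L))) →
    numAxioms π ≤ ∣ NmCpts π ∣)
    × (∃[ C ] (∀ {k} {Λ : Ctx k} {t : Term k} {L : GTy} → IsGround Λ →
    (π : Derivation Λ t (pos (ground L))) →
    cost π ≤ C * (numAxioms π * 2 ^ ∣ NmCpts π ∣)))
proposition9p1 R =
    (λ _ π → numAxioms≤∣NmCpts∣ R π)
  , 1 , λ _ π → ≤-trans (cost-≤ R π) (≤-reflexive (sym (*-identityˡ _)))
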